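{- Let $m \geq 2$ be an integer and let $k = 2^m - 1$. Then there exists an intersecting $k$-family $\mathcal{F}$ in which every vertex has degree $3$ and whose length is $2k+1$. In particular, the transversal size of $\mathcal{F}$ is at least $(2k+1)/3$.
   Context: A $k$-set is a set with $k$ elements. A $k$-family is a collection of $k$-sets; its members are called blocks, and its length (or size) is the number of blocks in it. The set of vertices of a $k$-family $\mathcal{F}$ is $\bigcup_{F \in \mathcal{F}} F$, and the degree of a vertex is the number of blocks of $\mathcal{F}$ containing it. A $k$-family $\mathcal{F}$ is intersecting if $F \cap G \neq \emptyset$ for all $F, G \in \mathcal{F}$. A set $C$ is a covering set of $\mathcal{F}$ if $C \cap F \neq \emptyset$ for all $F \in \mathcal{F}$. The transversal size of $\mathcal{F}$ is the smallest integer $t$ such that there exists a covering set of $\mathcal{F}$ with exactly $t$ elements. -}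

module Defs where

open import Data.Fin using (Fin)
open import Data.Fin.Subset using (Subset; _∩_; ∣_∣; Nonempty; ⋃)
open import Data.Fin.Subset.Properties using (_∈?_)
open import Data.List using (List; filter)
import Data.List as List
import Data.List.Membership.Propositional as ListMem
open import Data.List.Relation.Unary.All using (All)
open import Data.List.Relation.Unary.Unique.Propositional using (Unique)
open import Data.Nat using (ℕ; _≤_)
open import Data.Product using (_×_; ∃-syntax)
open import Relation.Binary.PropositionalEquality using (_≡_)

-- All sets live in the ambient ground set Fin n.  The ambient set may be
-- larger than the vertex set of the family, which is the union of its blocks.
-- Since Subset n is a type of characteristic vectors, propositional equality
-- of blocks is equality of sets, so a duplicate-free list is a set of blocks.
record Family (n k : ℕ) : Set where
  field
    blocks  : List (Subset n)
    unique  : Unique blocks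
    uniform : All (λ F → ∣ F ∣ ≡ k) blocks

  IsBlock : Subset n → Set
  IsBlock F = F ListMem.∈ blocks

  length : ℕ
  length = List.length blocks

  vertices : Subset n
  vertices = ⋃ blocks

  degree : Fin n → ℕ
  degree v = List.length (filter (v ∈?_) blocks)

  Intersecting : Set
  Intersecting = ∀ F G → IsBlock F → IsBlock G → Nonempty (F ∩ G)

  Covering : Subset n → Set
  Covering C = ∀ F → IsBlock F → Nonempty (C ∩ F)

  IsTransversalSize : ℕ → Set
  IsTransversalSize t =
    (∃[ C ] (Covering C × ∣ C ∣ ≡ t)) ×
    (∀ s → (∃[ C ] (Covering C × ∣ C ∣ ≡ s)) → t ≤ s)

{-# OPTIONS --safe #-}
module Submission where

-- The family is dual to the projective space PG(m,2): blocks are the 2k+1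
-- points, vertices are the lines, and a block consists of the k lines through
-- its point.  Lines have three points, and two points are on exactly one line.
-- PG(d+1,2) arises from PG(d,2) by the doubling construction of Steiner triple
-- systems, so the incidence numbers follow by recursion on d.  Blocks of
-- distinct points share one vertex and have k > 1 elements, so they differ.
-- A covering set C satisfies 2k+1 ≤ Σ_F |C ∩ F| = Σ_{v ∈ C} deg v = 3|C|.

open import Data.Bool using (Bool; true; false; _∧_; _∨_; _xor_; if_then_else_)
import Data.Bool as Bool
open import Data.Bool.Properties using (∧-comm; ∧-zeroʳ; ∧-identityʳ)
open import Data.Fin using (Fin; zero; suc)
open import Data.Fin.Subset using (Subset; Nonempty; ∣_∣; _∈_; _∩_; ⊤)
open import Data.Fin.Subset.Properties using (_∈?_; nonempty?; anySubset?; Empty-unique; ∣⊥∣≡0; ∣⁅x⁆∣≡1; x∈⁅y⁆⇒x≡y; p⊆q⇒∣p∣≤∣q∣; ∩-idem; ∩-identityˡ)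
open import Data.Integer using (+_)
import Data.Integer as ℤ
import Data.Integer.Properties as ℤ
open import Data.List using (List; []; _∷_; _++_; [_]; map; concatMap; filter)
import Data.List as List
import Data.List.Membership.Propositional as List
open import Data.List.Membership.Propositional.Properties using (∈-lookup; ∈-map⁻)
open import Data.List.Properties using (map-++; map-∘; map-cong; length-++; length-map)
open import Data.List.Relation.Unary.All using (All; []; _∷_; all?)
import Data.List.Relation.Unary.All as All
import Data.List.Relation.Unary.All.Properties as All
open import Data.List.Relation.Unary.AllPairs using ([]; _∷_)
open import Data.List.Relation.Unary.Any using (here; there)
open import Data.List.Relation.Unary.Unique.Propositional using (Unique)
import Data.List.Relation.Unary.Unique.Propositional.Properties as Unique
open import Data.Nat using (ℕ; zero; suc; _+_; _*_; _∸_; _^_; _≤_; _<_; z≤n; s≤s)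
import Data.Nat as ℕ
open import Data.Nat.Induction using (<-rec)
open import Data.Nat.ListAction using (sum)
open import Data.Nat.ListAction.Properties using (sum-++)
open import Data.Nat.Properties hiding (_≟_)
open import Data.Nat.Tactic.RingSolver using (solve-∀)
open import Data.Product using (∃; Σ-syntax; ∃-syntax; _×_; _,_; proj₁)
open import Data.Rational using (_/_; toℚᵘ) renaming (_≤_ to _≤ℚ_)
open import Data.Rational.Properties using (toℚᵘ-cancel-≤; toℚᵘ-fromℚᵘ)
import Data.Rational.Unnormalised as ℚᵘ
import Data.Rational.Unnormalised.Properties as ℚᵘ
open import Data.Vec using ([]; _∷_)
import Data.Vec as Vec
open import Function using (_∘_; mk⇔)
open import Relation.Binary.PropositionalEquality using (_≡_; _≢_; _≗_; refl; sym; trans; cong; cong₂; subst; module ≡-Reasoning)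
open import Relation.Nullary using (Dec; yes; no; does; contradiction)
open import Relation.Nullary.Decidable using (map′; _×-dec_; dec-false; does-⇔)
open import Relation.Unary using (Decidable)
import Algebra.Properties.CommutativeSemigroup +-commutativeSemigroup as +
open import Defs using (Family; module Family)

private
  variable
    A B : Set
    d n : ℕ

-- Counting list entries that pass a Boolean test

indicator : Bool → ℕ
indicator b = if b then 1 else 0

count : (A → Bool) → List A → ℕ
count f xs = sum (map (indicator ∘ f) xs)

count-++ : (f : A → Bool) (xs ys : List A) → count f (xs ++ ys) ≡ count f xs + count f ys
count-++ f xs ys = trans (cong sum (map-++ _ xs ys)) (sum-++ (map _ xs) _)

count-map : (f : B → Bool) (h : A → B) (xs : List A) → count f (map h xs) ≡ count (f ∘ h) xs
count-map f h xs = cong sum (sym (map-∘ xs))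

count-cong : {f g : A → Bool} → f ≗ g → (xs : List A) → count f xs ≡ count g xs
count-cong f≗g xs = cong sum (map-cong (cong indicator ∘ f≗g) xs)

count-false : {f : A → Bool} → (∀ x → f x ≡ false) → (xs : List A) → count f xs ≡ 0
count-false f≡false []       = refl
count-false f≡false (x ∷ xs) rewrite f≡false x = count-false f≡false xs

count-true : {f : A → Bool} → (∀ x → f x ≡ true) → (xs : List A) → count f xs ≡ List.length xs
count-true f≡true []       = refl
count-true f≡true (x ∷ xs) rewrite f≡true x = cong suc (count-true f≡true xs)

count-∨ : {f g : A → Bool} → (∀ x → f x ∧ g x ≡ false) → (xs : List A) →
          count (λ x → f x ∨ g x) xs ≡ count f xs + count g xs
count-∨ disjoint [] = refl
count-∨ {f = f} {g} disjoint (x ∷ xs) with f x | g x | disjoint x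
... | false | false | _ = count-∨ disjoint xs
... | true  | false | _ = cong suc (count-∨ disjoint xs)
... | false | true  | _ = trans (cong suc (count-∨ disjoint xs)) (sym (+-suc (count f xs) _))

-- Carries a count over lifted lines back to the lines one dimension lower: `c` is the number of
-- lifts passing `f` above each line that passes `g`. The hypothesis ranges over the entries of `xs`
-- only, because lines are known to have distinct points while arbitrary triples are not.
count-concatMap : (c : ℕ) (f : B → Bool) (g : A → Bool) (h : A → List B) {xs : List A} →
                  All (λ x → count f (h x) ≡ c * indicator (g x)) xs →
                  count f (concatMap h xs) ≡ c * count g xs
count-concatMap c f g h [] = sym (*-zeroʳ c)
count-concatMap c f g h {x ∷ xs} (eq ∷ eqs) = begin
  count f (h x ++ concatMap h xs)           ≡⟨ count-++ f (h x) _ ⟩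
  count f (h x) + count f (concatMap h xs)  ≡⟨ cong₂ _+_ eq (count-concatMap c f g h eqs) ⟩
  c * indicator (g x) + c * count g xs      ≡⟨ *-distribˡ-+ c (indicator (g x)) _ ⟨
  c * (indicator (g x) + count g xs)        ∎
  where open ≡-Reasoning

-- Points of the projective space over 𝔽₂

-- Nonzero vectors of 𝔽₂^(d+1): origin is the vector 1 of 𝔽₂, ∞ is (1,0,…,0)
-- and s ▹ x is x with the coordinate s put in front.
data Point : ℕ → Set where
  origin : Point 0
  ∞      : Point (suc d)
  _▹_    : Bool → Point d → Point (suc d)

infixr 6 _▹_

▹-injective : ∀ {s t} {x y : Point d} → s ▹ x ≡ t ▹ y → x ≡ y × s ≡ t
▹-injective refl = refl , refl

infix 4 _≟_ _==_

_≟_ : (x y : Point d) → Dec (x ≡ y)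
origin ≟ origin = yes refl
∞      ≟ ∞      = yes refl
∞      ≟ t ▹ y  = no λ()
s ▹ x  ≟ ∞      = no λ()
-- The points are compared before the coordinates, so the result reduces to `false` as soon as
-- `x == y` does, whatever `s` and `t` are.
s ▹ x  ≟ t ▹ y  = map′ (λ { (refl , refl) → refl }) ▹-injective ((x ≟ y) ×-dec (s Bool.≟ t))

_==_ : Point d → Point d → Bool
x == y = does (x ≟ y)

==-comm : (x y : Point d) → (x == y) ≡ (y == x)
==-comm x y = does-⇔ (mk⇔ sym sym) (x ≟ y) (y ≟ x)

≢⇒disjointˡ : {x y : Point d} → x ≢ y → ∀ a → (x == a) ∧ (y == a) ≡ false
≢⇒disjointˡ {x = x} {y} x≢y a with x ≟ a
... | no _     = refl
... | yes refl = dec-false (y ≟ a) (x≢y ∘ sym)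

≢⇒disjointʳ : {a b : Point d} → a ≢ b → ∀ x → (x == a) ∧ (x == b) ≡ false
≢⇒disjointʳ {a = a} {b} a≢b x rewrite ==-comm x a | ==-comm x b = ≢⇒disjointˡ a≢b x

points : ∀ d → List (Point d)
points zero    = [ origin ]
points (suc d) = ∞ ∷ map (true ▹_) (points d) ++ map (false ▹_) (points d)

points-unique : ∀ d → Unique (points d)
points-unique zero    = [] ∷ []
points-unique (suc d) =
  All.++⁺ (∞-fresh true) (∞-fresh false) ∷
  Unique.++⁺ (▹-unique true) (▹-unique false) disjoint
  where
  ∞-fresh : ∀ s → All (∞ ≢_) (map (s ▹_) (points d))
  ∞-fresh s = All.map⁺ (All.universal (λ _ ()) (points d))
  ▹-unique : ∀ s → Unique (map (s ▹_) (points d))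
  ▹-unique s = Unique.map⁺ (proj₁ ∘ ▹-injective) (points-unique d)
  disjoint : ∀ {x} → x List.∈ map (true ▹_) (points d) × x List.∈ map (false ▹_) (points d) → _
  disjoint (p , q) with ∈-map⁻ (true ▹_) p | ∈-map⁻ (false ▹_) q
  ... | _ , _ , refl | _ , _ , ()

count-points : (f : Point (suc d) → Bool) →
  count f (points (suc d)) ≡
    indicator (f ∞) + (count (f ∘ (true ▹_)) (points d) + count (f ∘ (false ▹_)) (points d))
count-points {d} f = cong (indicator (f ∞) ℕ.+_) (trans
  (count-++ f (map (true ▹_) (points d)) _)
  (cong₂ _+_ (count-map f (true ▹_) (points d)) (count-map f (false ▹_) (points d))))

count-==ʳ : (a : Point d) → count (_== a) (points d) ≡ 1
count-==ʳ origin = refl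
count-==ʳ {suc d} ∞ = trans (count-points {d} (_== ∞))
  (cong suc (cong₂ _+_ (count-false (λ _ → refl) (points d)) (count-false (λ _ → refl) (points d))))
count-==ʳ {suc d} (true ▹ a) = trans (count-points (_== true ▹ a)) (cong₂ _+_
  (trans (count-cong (λ x → ∧-identityʳ (x == a)) (points d)) (count-==ʳ a))
  (count-false (λ x → ∧-zeroʳ (x == a)) (points d)))
count-==ʳ {suc d} (false ▹ a) = trans (count-points (_== false ▹ a)) (cong₂ _+_
  (count-false (λ x → ∧-zeroʳ (x == a)) (points d))
  (trans (count-cong (λ x → ∧-identityʳ (x == a)) (points d)) (count-==ʳ a)))

count-==ˡ : (a : Point d) → count (a ==_) (points d) ≡ 1
count-==ˡ {d} a = trans (count-cong (==-comm a) (points d)) (count-==ʳ a)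

-- The recursion k ↦ 2k + 1, obeyed by the number of lines through a point. Writing the positive
-- number `2 ^ d` as `suc p` removes the truncated subtraction.
2^1+d∸1 : ∀ d → 2 ^ suc d ∸ 1 ≡ 2 * (2 ^ d ∸ 1) + 1
2^1+d∸1 d with 2 ^ d | m^n>0 2 d
... | suc p | _ = lemma p
  where
  lemma : ∀ p → p + (suc p + 0) ≡ 2 * p + 1
  lemma = solve-∀

length-points : ∀ d → List.length (points d) ≡ 2 * (2 ^ d ∸ 1) + 1
length-points zero    = refl
length-points (suc d) rewrite length-++ (map (true ▹_) (points d)) {map (false ▹_) (points d)}
  | length-map (true ▹_) (points d) | length-map (false ▹_) (points d)
  | length-points d | 2^1+d∸1 d = lemma (2 * (2 ^ d ∸ 1) + 1)
  where
  lemma : ∀ v → suc (v + v) ≡ 2 * v + 1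
  lemma = solve-∀

-- Lines and the doubling construction

Triple : ℕ → Set
Triple d = Point d × Point d × Point d

hit : Point d → Triple d → Bool
hit x (a , b , c) = (x == a) ∨ (x == b) ∨ (x == c)

-- Three distinct points over 𝔽₂ are collinear when they sum to zero, so two of the new coordinates
-- determine the third.
lift : Triple d → Bool → Bool → Triple (suc d)
lift (a , b , c) s t = s ▹ a , t ▹ b , (s xor t) ▹ c

lifts : Triple d → List (Triple (suc d))
lifts u = lift u true true ∷ lift u true false ∷ lift u false true ∷ lift u false false ∷ []

vertical : Point d → Triple (suc d)
vertical x = ∞ , true ▹ x , false ▹ x

-- Sorted by projection from `∞`: a line missing `∞` projects onto a line of the smaller space,
-- which has four lifts, and a line through `∞` collapses to a point. Each line is listed with its
-- points in one chosen order.
lines : ∀ d → List (Triple d)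
lines zero    = []
lines (suc d) = concatMap lifts (lines d) ++ map vertical (points d)

count-lines : (f : Triple (suc d) → Bool) →
  count f (lines (suc d)) ≡ count f (concatMap lifts (lines d)) + count (f ∘ vertical) (points d)
count-lines {d} f = trans (count-++ f (concatMap lifts (lines d)) _)
  (cong (count f (concatMap lifts (lines d)) ℕ.+_) (count-map f vertical (points d)))

Distinct : Triple d → Set
Distinct (a , b , c) = a ≢ b × a ≢ c × b ≢ c

lines-distinct : ∀ d → All Distinct (lines d)
lines-distinct zero    = []
lines-distinct (suc d) = All.++⁺
  (All.concat⁺ (All.map⁺ (All.map lifts-distinct (lines-distinct d))))
  (All.map⁺ (All.universal (λ _ → (λ ()) , (λ ()) , (λ ())) (points d)))
  where
  lift-distinct : ∀ {u} → Distinct u → ∀ s t → Distinct (lift u s t)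
  lift-distinct (a≢b , a≢c , b≢c) s t =
    a≢b ∘ proj₁ ∘ ▹-injective , a≢c ∘ proj₁ ∘ ▹-injective , b≢c ∘ proj₁ ∘ ▹-injective
  lifts-distinct : ∀ {u} → Distinct u → All Distinct (lifts u)
  lifts-distinct δ = lift-distinct δ true true ∷ lift-distinct δ true false
    ∷ lift-distinct δ false true ∷ lift-distinct δ false false ∷ []

-- Becomes the degree 3 in the dual family. Since the entries differ, the three tests exclude each
-- other, and each is passed by exactly one point.
count-hit-points : (u : Triple d) → Distinct u → count (λ x → hit x u) (points d) ≡ 3
count-hit-points {d} (a , b , c) (a≢b , a≢c , b≢c) = trans
  (count-∨ disjoint (points d))
  (cong₂ _+_ (count-==ʳ a) (trans (count-∨ (≢⇒disjointʳ b≢c) (points d))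
                                  (cong₂ _+_ (count-==ʳ b) (count-==ʳ c))))
  where
  disjoint : ∀ x → (x == a) ∧ ((x == b) ∨ (x == c)) ≡ false
  disjoint x with x == a | ≢⇒disjointʳ a≢b x | ≢⇒disjointʳ a≢c x
  ... | false | _ | _ = refl
  ... | true  | p | q rewrite p | q = refl

-- Incidences of points with lifted and vertical lines

-- The possible outcomes of comparing a point with the distinct entries of a line. Matching on them
-- leaves four cases instead of eight, and in each the counts over `lifts` compute.
data AtMostOne : Bool → Bool → Bool → Set where
  none   : AtMostOne false false false
  first  : AtMostOne true  false false
  second : AtMostOne false true  false
  third  : AtMostOne false false true

locate : (x : Point d) ((a , b , c) : Triple d) → Distinct (a , b , c) →
         AtMostOne (x == a) (x == b) (x == c)
locate x (a , b , c) (a≢b , a≢c , b≢c)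
  with x == a | x == b | x == c | ≢⇒disjointʳ a≢b x | ≢⇒disjointʳ a≢c x | ≢⇒disjointʳ b≢c x
... | false | false | false | _ | _ | _ = none
... | true  | false | false | _ | _ | _ = first
... | false | true  | false | _ | _ | _ = second
... | false | false | true  | _ | _ | _ = third

-- Case analysis as a function, so that the new coordinates are split only in those clauses whose
-- count depends on them.
∀-Bool : {P : Bool → Set} → P true → P false → ∀ s → P s
∀-Bool p q true  = p
∀-Bool p q false = q

∀-Bool² : {P : Bool → Bool → Set} → P true true → P true false → P false true → P false false →
          ∀ s t → P s t
∀-Bool² p q r u true  true  = p
∀-Bool² p q r u true  false = q
∀-Bool² p q r u false true  = r
∀-Bool² p q r u false false = u

-- If `x` is on `u`, prescribing the coordinate above `x` fixes one of `s`, `t`, `s xor t` and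
-- leaves two of the four lifts.
count-hit-lifts : ∀ (x : Point d) u → Distinct u → ∀ s →
                  count (hit (s ▹ x)) (lifts u) ≡ 2 * indicator (hit x u)
count-hit-lifts x (a , b , c) δ with x == a | x == b | x == c | locate x (a , b , c) δ
... | _ | _ | _ | none   = λ _ → refl
... | _ | _ | _ | first  = ∀-Bool refl refl
... | _ | _ | _ | second = ∀-Bool refl refl
... | _ | _ | _ | third  = ∀-Bool refl refl

hit₂ : Point d → Point d → Triple d → Bool
hit₂ x y u = hit x u ∧ hit y u

-- Any two of `s`, `t`, `s xor t` determine the third, so prescribing the coordinates above two
-- points of `u` leaves one lift.
count-hit₂-lifts : ∀ {x y : Point d} → x ≢ y → ∀ u → Distinct u → ∀ s t →
                   count (hit₂ (s ▹ x) (t ▹ y)) (lifts u) ≡ 1 * indicator (hit₂ x y u)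
count-hit₂-lifts {x = x} {y} x≢y (a , b , c) δ
  with x == a | x == b | x == c | locate x (a , b , c) δ
     | y == a | y == b | y == c | locate y (a , b , c) δ
     -- These equations exclude the cases in which `x` and `y` are the same entry of the line.
     | ≢⇒disjointˡ x≢y a | ≢⇒disjointˡ x≢y b | ≢⇒disjointˡ x≢y c
... | _ | _ | _ | none   | _ | _ | _ | _      | _ | _ | _ = λ _ _ → refl
... | _ | _ | _ | first  | _ | _ | _ | none   | _ | _ | _ = ∀-Bool² refl refl refl refl
... | _ | _ | _ | first  | _ | _ | _ | second | _ | _ | _ = ∀-Bool² refl refl refl refl
... | _ | _ | _ | first  | _ | _ | _ | third  | _ | _ | _ = ∀-Bool² refl refl refl refl
... | _ | _ | _ | second | _ | _ | _ | none   | _ | _ | _ = ∀-Bool² refl refl refl refl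
... | _ | _ | _ | second | _ | _ | _ | first  | _ | _ | _ = ∀-Bool² refl refl refl refl
... | _ | _ | _ | second | _ | _ | _ | third  | _ | _ | _ = ∀-Bool² refl refl refl refl
... | _ | _ | _ | third  | _ | _ | _ | none   | _ | _ | _ = ∀-Bool² refl refl refl refl
... | _ | _ | _ | third  | _ | _ | _ | first  | _ | _ | _ = ∀-Bool² refl refl refl refl
... | _ | _ | _ | third  | _ | _ | _ | second | _ | _ | _ = ∀-Bool² refl refl refl refl

-- A lift has a single point above each entry of `u`, so it cannot contain both points above `x`;
-- these are joined by a vertical line instead.
count-hit₂-lifts-same : ∀ (x : Point d) {s t} → s ≢ t → ∀ u → Distinct u →
                        count (hit₂ (s ▹ x) (t ▹ x)) (lifts u) ≡ 0
count-hit₂-lifts-same x {true}  {true}  s≢t _ _ = contradiction refl s≢t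
count-hit₂-lifts-same x {false} {false} s≢t _ _ = contradiction refl s≢t
count-hit₂-lifts-same x {true}  {false} s≢t (a , b , c) δ
  with x == a | x == b | x == c | locate x (a , b , c) δ
... | _ | _ | _ | none   = refl
... | _ | _ | _ | first  = refl
... | _ | _ | _ | second = refl
... | _ | _ | _ | third  = refl
count-hit₂-lifts-same x {false} {true}  s≢t (a , b , c) δ
  with x == a | x == b | x == c | locate x (a , b , c) δ
... | _ | _ | _ | none   = refl
... | _ | _ | _ | first  = refl
... | _ | _ | _ | second = refl
... | _ | _ | _ | third  = refl

hit-vertical : ∀ s (x y : Point d) → hit (s ▹ x) (vertical y) ≡ (x == y)
hit-vertical true  x y with x == y
... | true  = refl
... | false = refl
hit-vertical false x y with x == y
... | true  = refl
... | false = refl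

-- Lines through one point and through two points

-- Through `∞` there is one vertical line for each point of the smaller space. Through `s ▹ x` there
-- are two lifts of each line through `x`, and the vertical line over `x`.
count-hit : (x : Point d) → count (hit x) (lines d) ≡ 2 ^ d ∸ 1
count-hit origin = refl
count-hit {suc d} ∞ = begin
  count (hit ∞) (lines (suc d))
    ≡⟨ count-lines {d} (hit ∞) ⟩
  count (hit ∞) (concatMap lifts (lines d)) + count (hit ∞ ∘ vertical) (points d)
    -- No lift passes through `∞`, so the multiplicity is 0 and the constant test is only a
    -- placeholder.
    ≡⟨ cong₂ _+_ (count-concatMap 0 (hit ∞) (λ _ → false) lifts (All.universal (λ _ → refl) (lines d)))
                 (count-true (λ _ → refl) (points d)) ⟩
  List.length (points d)
    ≡⟨ trans (length-points d) (sym (2^1+d∸1 d)) ⟩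
  2 ^ suc d ∸ 1 ∎
  where open ≡-Reasoning
count-hit {suc d} (s ▹ x) = begin
  count (hit (s ▹ x)) (lines (suc d))
    ≡⟨ count-lines (hit (s ▹ x)) ⟩
  count (hit (s ▹ x)) (concatMap lifts (lines d)) + count (hit (s ▹ x) ∘ vertical) (points d)
    ≡⟨ cong₂ _+_ (count-concatMap 2 (hit (s ▹ x)) (hit x) lifts
                    (All.map (λ {u} δ → count-hit-lifts x u δ s) (lines-distinct d)))
                 (trans (count-cong (hit-vertical s x) (points d)) (count-==ˡ x)) ⟩
  2 * count (hit x) (lines d) + 1
    ≡⟨ cong (λ c → 2 * c + 1) (count-hit x) ⟩
  2 * (2 ^ d ∸ 1) + 1
    ≡⟨ 2^1+d∸1 d ⟨
  2 ^ suc d ∸ 1 ∎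
  where open ≡-Reasoning

-- If one point is `∞`, or both project to the same point, the joining line is vertical and no lift
-- qualifies. Otherwise the line joining the projections has a unique suitable lift, and no vertical
-- line qualifies.
count-hit₂ : {x y : Point d} → x ≢ y → count (hit₂ x y) (lines d) ≡ 1
count-hit₂ {x = origin} {origin} x≢y = contradiction refl x≢y
count-hit₂ {x = ∞} {∞} x≢y = contradiction refl x≢y
count-hit₂ {suc d} {∞} {t ▹ y} x≢y = trans (count-lines (hit₂ ∞ (t ▹ y))) (cong₂ _+_
  (count-concatMap 0 (hit₂ ∞ (t ▹ y)) (λ _ → false) lifts (All.universal (λ _ → refl) (lines d)))
  (trans (count-cong (hit-vertical t y) (points d)) (count-==ˡ y)))
count-hit₂ {suc d} {s ▹ x} {∞} x≢y = trans
  -- `hit ∞` computes on lifted and vertical lines, so it is moved to the front, where the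
  -- conjunction reduces.
  (count-cong (λ u → ∧-comm (hit (s ▹ x) u) (hit ∞ u)) (lines (suc d)))
  (trans (count-lines (hit₂ ∞ (s ▹ x))) (cong₂ _+_
    (count-concatMap 0 (hit₂ ∞ (s ▹ x)) (λ _ → false) lifts (All.universal (λ _ → refl) (lines d)))
    (trans (count-cong (hit-vertical s x) (points d)) (count-==ˡ x))))
count-hit₂ {suc d} {s ▹ x} {t ▹ y} sx≢ty with x ≟ y
... | yes refl = trans (count-lines (hit₂ (s ▹ x) (t ▹ x))) (cong₂ _+_
  (count-concatMap 0 (hit₂ (s ▹ x) (t ▹ x)) (λ _ → false) lifts
    (All.map (λ {u} → count-hit₂-lifts-same x (sx≢ty ∘ cong (_▹ x)) u) (lines-distinct d)))
  (trans (count-cong vertical-hit₂ (points d)) (count-==ˡ x)))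
  where
  vertical-hit₂ : ∀ z → hit₂ (s ▹ x) (t ▹ x) (vertical z) ≡ (x == z)
  vertical-hit₂ z rewrite hit-vertical s x z | hit-vertical t x z with x == z
  ... | true  = refl
  ... | false = refl
... | no x≢y = trans (count-lines (hit₂ (s ▹ x) (t ▹ y))) (cong₂ _+_
  (trans (count-concatMap 1 (hit₂ (s ▹ x) (t ▹ y)) (hit₂ x y) lifts
           (All.map (λ {u} δ → count-hit₂-lifts x≢y u δ s t) (lines-distinct d)))
         (trans (*-identityˡ _) (count-hit₂ x≢y)))
  (count-false vertical-hit₂ (points d)))
  where
  vertical-hit₂ : ∀ z → hit₂ (s ▹ x) (t ▹ y) (vertical z) ≡ false
  vertical-hit₂ z rewrite hit-vertical s x z | hit-vertical t y z = ≢⇒disjointˡ x≢y z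

-- Characteristic vectors, cardinalities and degrees

-- The ground set consists of the positions in `xs`, so that cardinalities of subsets become counts
-- over the list.
select : (A → Bool) → (xs : List A) → Subset (List.length xs)
select f xs = Vec.map f (Vec.fromList xs)

∣select∣ : (f : A → Bool) (xs : List A) → ∣ select f xs ∣ ≡ count f xs
∣select∣ f [] = refl
∣select∣ f (x ∷ xs) with f x
... | true  = cong suc (∣select∣ f xs)
... | false = ∣select∣ f xs

select-∩ : (f g : A → Bool) (xs : List A) → select f xs ∩ select g xs ≡ select (λ x → f x ∧ g x) xs
select-∩ f g []       = refl
select-∩ f g (x ∷ xs) = cong (_ ∷_) (select-∩ f g xs)

lookup-select : (f : A → Bool) (xs : List A) (i : Fin (List.length xs)) →
                Vec.lookup (select f xs) i ≡ f (List.lookup xs i)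
lookup-select f (x ∷ xs) zero    = refl
lookup-select f (x ∷ xs) (suc i) = lookup-select f xs i

∣p∣>0⇒nonempty : (p : Subset n) → 0 < ∣ p ∣ → Nonempty p
∣p∣>0⇒nonempty {n} p ∣p∣>0 with nonempty? p
... | yes ne = ne
... | no ¬ne = contradiction (trans (cong ∣_∣ (Empty-unique ¬ne)) (∣⊥∣≡0 n)) (>⇒≢ ∣p∣>0)

nonempty⇒∣p∣>0 : {p : Subset n} → Nonempty p → 0 < ∣ p ∣
nonempty⇒∣p∣>0 {p = p} (x , x∈p) = subst (_≤ ∣ p ∣) (∣⁅x⁆∣≡1 x)
  (p⊆q⇒∣p∣≤∣q∣ λ y∈⁅x⁆ → subst (_∈ p) (sym (x∈⁅y⁆⇒x≡y x y∈⁅x⁆)) x∈p)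

-- Reconciles `filter` by membership, as in `degree`, with counting bits of characteristic vectors.
does-∈? : (v : Fin n) (p : Subset n) → does (v ∈? p) ≡ Vec.lookup p v
does-∈? zero    (true  ∷ p) = refl
does-∈? zero    (false ∷ p) = refl
does-∈? (suc v) (_     ∷ p) = does-∈? v p

degree≡count : (v : Fin n) (Fs : List (Subset n)) →
               List.length (filter (v ∈?_) Fs) ≡ count (λ F → Vec.lookup F v) Fs
degree≡count v [] = refl
degree≡count v (F ∷ Fs) with does (v ∈? F) | does-∈? v F
... | true  | eq rewrite sym eq = cong suc (degree≡count v Fs)
... | false | eq rewrite sym eq = degree≡count v Fs

-- Double counting of incidences

incidences : Subset n → List (Subset n) → ℕ
incidences C Fs = sum (map (λ F → ∣ C ∩ F ∣) Fs)

incidences-inside : (C : Subset n) (Fs : List (Subset (suc n))) →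
  incidences (true ∷ C) Fs ≡ count Vec.head Fs + incidences C (map Vec.tail Fs)
incidences-inside C [] = refl
incidences-inside C ((true ∷ F) ∷ Fs) = cong suc (trans
  (cong (∣ C ∩ F ∣ ℕ.+_) (incidences-inside C Fs)) (+.x∙yz≈y∙xz ∣ C ∩ F ∣ (count Vec.head Fs) _))
incidences-inside C ((false ∷ F) ∷ Fs) = trans
  (cong (∣ C ∩ F ∣ ℕ.+_) (incidences-inside C Fs)) (+.x∙yz≈y∙xz ∣ C ∩ F ∣ (count Vec.head Fs) _)

incidences-outside : (C : Subset n) (Fs : List (Subset (suc n))) →
  incidences (false ∷ C) Fs ≡ incidences C (map Vec.tail Fs)
incidences-outside C []             = refl
incidences-outside C ((_ ∷ F) ∷ Fs) = cong (∣ C ∩ F ∣ ℕ.+_) (incidences-outside C Fs)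

-- Induction on the ground set replaces an exchange of sums: deleting the first vertex from `C` and
-- from every block loses at most the degree of that vertex, and loses nothing if the vertex is
-- outside `C`.
incidences-≤ : ∀ {δ} (C : Subset n) (Fs : List (Subset n)) →
               (∀ v → count (λ F → Vec.lookup F v) Fs ≤ δ) → incidences C Fs ≤ ∣ C ∣ * δ
incidences-≤ [] [] deg≤ = z≤n
incidences-≤ {δ = δ} [] ([] ∷ Fs) deg≤ = incidences-≤ {δ = δ} [] Fs (λ ())
incidences-≤ {δ = δ} (c ∷ C) Fs deg≤ = head-case c
  where
  head-lookup : ∀ {n} (F : Subset (suc n)) → Vec.lookup F zero ≡ Vec.head F
  head-lookup (_ ∷ _) = refl
  tail-lookup : ∀ {n} (v : Fin n) (F : Subset (suc n)) → Vec.lookup (Vec.tail F) v ≡ Vec.lookup F (suc v)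
  tail-lookup v (_ ∷ _) = refl
  tails : incidences C (map Vec.tail Fs) ≤ ∣ C ∣ * δ
  tails = incidences-≤ C (map Vec.tail Fs) λ v → subst (_≤ δ)
    (sym (trans (count-map _ Vec.tail Fs) (count-cong (tail-lookup v) Fs))) (deg≤ (suc v))
  head-case : ∀ c → incidences (c ∷ C) Fs ≤ ∣ c ∷ C ∣ * δ
  head-case true  = subst (_≤ δ + ∣ C ∣ * δ) (sym (incidences-inside C Fs))
    (+-mono-≤ (subst (_≤ δ) (count-cong head-lookup Fs) (deg≤ zero)) tails)
  head-case false = subst (_≤ ∣ C ∣ * δ) (sym (incidences-outside C Fs)) tails

length≤incidences : (C : Subset n) (Fs : List (Subset n)) →
                    (∀ F → F List.∈ Fs → Nonempty (C ∩ F)) → List.length Fs ≤ incidences C Fs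
length≤incidences C [] cover = z≤n
length≤incidences C (F ∷ Fs) cover = +-mono-≤ (nonempty⇒∣p∣>0 (cover F (here refl)))
  (length≤incidences C Fs (λ G → cover G ∘ there))

-- Existence and lower bound of the transversal size

-- Descent from a known witness: as long as a bounded search finds a smaller one, continue from
-- there.
least : {P : ℕ → Set} → Decidable P → ∀ n → P n → ∃[ t ] (P t × (∀ s → P s → t ≤ s))
least {P} P? = <-rec _ step
  where
  step : ∀ n → (∀ {i} → i < n → P i → ∃[ t ] (P t × (∀ s → P s → t ≤ s))) →
         P n → ∃[ t ] (P t × (∀ s → P s → t ≤ s))
  step n rec Pn with anyUpTo? P? n
  ... | yes (i , i<n , Pi) = rec i<n Pi
  ... | no ¬smaller        = n , Pn , λ s Ps → ≮⇒≥ λ s<n → ¬smaller (s , s<n , Ps)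

module _ {n k : ℕ} (𝓕 : Family n k) where
  open Family 𝓕 renaming (length to size)

  covering? : Decidable Covering
  covering? C = map′ (λ all F → All.lookup all) (λ cover → All.tabulate (cover _))
                     (all? (λ F → nonempty? (C ∩ F)) blocks)

  transversalSize : ∃ Covering → ∃ IsTransversalSize
  transversalSize (C , cover) = least
    -- Having a covering set of size `s` is decidable because the ground set has finitely many
    -- subsets; the search starts from the size of the given `C`.
    (λ s → anySubset? λ D → covering? D ×-dec (∣ D ∣ ℕ.≟ s)) ∣ C ∣ (C , cover , refl)

  ⊤-covering : 0 < k → Covering ⊤
  ⊤-covering k>0 F F∈ = ∣p∣>0⇒nonempty (⊤ ∩ F)
    (subst (0 <_) (sym (trans (cong ∣_∣ (∩-identityˡ F)) (All.lookup uniform F∈))) k>0)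

  size≤transversalSize*δ : ∀ {δ t} → (∀ v → degree v ≤ δ) → IsTransversalSize t → size ≤ t * δ
  size≤transversalSize*δ {δ} deg≤ ((C , cover , refl) , _) = ≤-trans
    (length≤incidences C blocks cover)
    (incidences-≤ C blocks λ v → subst (_≤ δ) (degree≡count v blocks) (deg≤ v))

-- Passing to unnormalised fractions turns the inequality into its cross-multiplied form.
m≤t*3⇒m/3≤t : ∀ {m t} → m ≤ t * 3 → (+ m) / 3 ≤ℚ (+ t) / 1
m≤t*3⇒m/3≤t {m} {t} m≤t*3 = toℚᵘ-cancel-≤ (begin
  -- `mkℚᵘ` stores the denominator minus one, so the arguments `2` and `0` stand for the
  -- denominators 3 and 1.
  toℚᵘ ((+ m) / 3)  ≃⟨ toℚᵘ-fromℚᵘ (ℚᵘ.mkℚᵘ (+ m) 2) ⟩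
  ℚᵘ.mkℚᵘ (+ m) 2                 ≤⟨ ℚᵘ.*≤* inequality ⟩
  ℚᵘ.mkℚᵘ (+ t) 0                 ≃⟨ toℚᵘ-fromℚᵘ (ℚᵘ.mkℚᵘ (+ t) 0) ⟨
  toℚᵘ ((+ t) / 1)  ∎)
  where
  open ℚᵘ.≤-Reasoning
  inequality : (+ m) ℤ.* (+ 1) ℤ.≤ (+ t) ℤ.* (+ 3)
  inequality rewrite ℤ.*-identityʳ (+ m) | sym (ℤ.pos-* t 3) = ℤ.+≤+ m≤t*3

-- The family dual to the projective space

module DualSystem (m : ℕ) (2≤m : 2 ≤ m) where

  k : ℕ
  k = 2 ^ m ∸ 1

  1<k : 1 < k
  -- From `2 ≤ m` follows 3 ≤ `k`, and the first argument is 2 ≤ 3.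
  1<k = ≤-trans (s≤s (s≤s z≤n)) (∸-monoˡ-≤ 1 (^-monoʳ-≤ 2 2≤m))

  star : Point m → Subset (List.length (lines m))
  star x = select (hit x) (lines m)

  ∣star∣ : ∀ x → ∣ star x ∣ ≡ k
  ∣star∣ x = trans (∣select∣ (hit x) (lines m)) (count-hit x)

  ∣star∩star∣ : ∀ {x y} → x ≢ y → ∣ star x ∩ star y ∣ ≡ 1
  ∣star∩star∣ {x} {y} x≢y = trans (cong ∣_∣ (select-∩ (hit x) (hit y) (lines m)))
    (trans (∣select∣ (hit₂ x y) (lines m)) (count-hit₂ x≢y))

  star-injective : ∀ {x y} → star x ≡ star y → x ≡ y
  star-injective {x} {y} eq with x ≟ y
  ... | yes x≡y = x≡y
  ... | no  x≢y = contradiction k≡1 (>⇒≢ 1<k)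
    where
    k≡1 : k ≡ 1
    k≡1 = trans (sym (∣star∣ x)) (trans (cong ∣_∣ (trans (sym (∩-idem (star x))) (cong (star x ∩_) eq)))
      (∣star∩star∣ x≢y))

  family : Family (List.length (lines m)) k
  family = record
    { blocks  = map star (points m)
    ; unique  = Unique.map⁺ star-injective (points-unique m)
    ; uniform = All.map⁺ (All.universal ∣star∣ (points m))
    }

  open Family family renaming (length to size)

  intersecting : Intersecting
  intersecting F G F∈ G∈ with ∈-map⁻ star F∈ | ∈-map⁻ star G∈
  ... | x , _ , refl | y , _ , refl = ∣p∣>0⇒nonempty (star x ∩ star y) positive
    where
    positive : 0 < ∣ star x ∩ star y ∣
    positive with x ≟ y
    -- `Intersecting` also compares a block with itself; the intersection is then the block, which
    -- has `k` > 0 elements.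
    ... | yes refl = subst (0 <_) (sym (trans (cong ∣_∣ (∩-idem (star x))) (∣star∣ x))) (<⇒≤ 1<k)
    ... | no  x≢y  = ≤-reflexive (sym (∣star∩star∣ x≢y))

  -- The blocks containing `v` are the stars of the points on the line at position `v`.
  degree≡3 : ∀ v → degree v ≡ 3
  degree≡3 v = begin
    degree v                                       ≡⟨ degree≡count v blocks ⟩
    count (λ F → Vec.lookup F v) blocks            ≡⟨ count-map _ star (points m) ⟩
    count (λ x → Vec.lookup (star x) v) (points m) ≡⟨ count-cong (λ x → lookup-select (hit x) (lines m) v) (points m) ⟩
    count (λ x → hit x (List.lookup (lines m) v)) (points m)
      ≡⟨ count-hit-points _ (All.lookup (lines-distinct m) (∈-lookup v)) ⟩
    3                                              ∎
    where open ≡-Reasoning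

  size≡2k+1 : size ≡ 2 * k + 1
  size≡2k+1 = trans (length-map star (points m)) (length-points m)

  transversal : ∃[ t ] (IsTransversalSize t × (+ (2 * k + 1)) / 3 ≤ℚ (+ t) / 1)
  transversal with t , isTS ← transversalSize family (⊤ , ⊤-covering family (<⇒≤ 1<k)) =
    t , isTS , m≤t*3⇒m/3≤t {t = t} (subst (_≤ t * 3) size≡2k+1
      (size≤transversalSize*δ family (≤-reflexive ∘ degree≡3) isTS))

theorem2p4 : (m : ℕ) → 2 ≤ m → let k = 2 ^ m ∸ 1 in
    ∃[ n ] Σ[ 𝓕 ∈ Family n k ] let open Family 𝓕 in
    Intersecting
    × (∀ v → v ∈ vertices → degree v ≡ 3)
    × length ≡ 2 * k + 1
    × (∃[ t ] (IsTransversalSize t × (+ (2 * k + 1)) / 3 ≤ℚ (+ t) / 1))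
theorem2p4 m 2≤m =
  List.length (lines m) , family , intersecting , (λ v _ → degree≡3 v) , size≡2k+1 , transversal
  where open DualSystem m 2≤m
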